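{- Let $L\in\mathcal L$ be a lower real and let $U=\{q\in\mathbb Q\mid\exists_{s\in\mathbb Q\setminus L}\,s<q\}$. Then $L$ is a sharp element of the continuous dcpo $\mathcal L$ if and only if the pair $(L,U)$ is located, i.e. for every $p,q\in\mathbb Q$ with $p<q$ we have $p\in L$ or $q\in U$.
   Context: Everything is constructive: neither excluded middle nor choice is assumed. A subset $S$ of a poset is directed if it is inhabited and any two elements of $S$ have an upper bound in $S$. A dcpo is a poset $(D,\sqsubseteq)$ in which every directed subset $S$ has a supremum $\bigsqcup S$. Write $x\ll y$ if for every directed $S$ with $y\sqsubseteq\bigsqcup S$ there is $s\in S$ with $x\sqsubseteq s$. $D$ is continuous if for every $x$ the set $\{y\in D\mid y\ll x\}$ is directed with supremum $x$. An element $x\in D$ is sharp if for every $y,z\in D$ with $y\ll z$ we have $y\ll x$ or $\lnot(z\sqsubseteq x)$. $\mathcal L$ is the rounded ideal completion of $(\mathbb Q,<)$: its elements (lower reals) are the subsets $L\subseteq\mathbb Q$ that are lower sets with respect to $<$ and directed with respect to $<$ (inhabited, and for all $p,q\in L$ there is $r\in L$ with $p<r$ and $q<r$), ordered by inclusion, with directed suprema given by unions. It is a continuous dcpo. -}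

module Defs where

open import Data.Product using (∃; _×_; _,_; proj₁; proj₂)
open import Data.Rational using (ℚ; _<_; _⊔_; _+_; -_; 0ℚ; 1ℚ; _<?_)
open import Data.Rational.Properties
  using (<-dense; <-trans; ≤-<-trans; p≤p⊔q; p≤q⊔p; ⊔-sel; +-monoʳ-<; +-identityʳ)
open import Data.Sum using (_⊎_; inj₁; inj₂)
open import Level using (Level; 0ℓ) renaming (suc to lsuc; _⊔_ to _⊔ˡ_)
open import Relation.Binary using (Rel; Poset)
open import Relation.Binary.PropositionalEquality using (subst; sym)
open import Relation.Nullary using (¬_)
open import Relation.Nullary.Decidable using (from-yes)
open import Relation.Unary using (Pred; _∈_; _∉_; _⊆_; _≐_)

module _ {a ℓ s} {A : Set a} (_∼_ : Rel A ℓ) (S : Pred A s) where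

  Inhabited : Set (a ⊔ˡ s)
  Inhabited = ∃ λ x → x ∈ S

  IsDirected : Set (a ⊔ˡ ℓ ⊔ˡ s)
  IsDirected =
    Inhabited × (∀ x y → x ∈ S → y ∈ S → ∃ λ z → z ∈ S × x ∼ z × y ∼ z)

  IsSupremum : A → Set (a ⊔ˡ ℓ ⊔ˡ s)
  IsSupremum x =
    (∀ y → y ∈ S → y ∼ x) × (∀ z → (∀ y → y ∈ S → y ∼ z) → x ∼ z)

-- Agda is predicative, so "every directed subset" has to be read relative to a
-- universe level ι: the subsets in question are those that can be enumerated,
-- up to the equality of the poset, by a type in Set ι.  (Any such subset is
-- logically equivalent to a predicate of level ι ⊔ ℓ₁ and respects _≈_.)

module _ {c ℓ₁ ℓ₂} (P : Poset c ℓ₁ ℓ₂) where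
  open Poset P

  Image : ∀ {i} {I : Set i} → (I → Carrier) → Pred Carrier (i ⊔ˡ ℓ₁)
  Image α x = ∃ λ i → x ≈ α i

  IsSmall : ∀ ι → Pred Carrier (ι ⊔ˡ ℓ₁) → Set (c ⊔ˡ ℓ₁ ⊔ˡ lsuc ι)
  IsSmall ι S = ∃ λ (I : Set ι) → ∃ λ (α : I → Carrier) → S ≐ Image α

record DCPO (ι c ℓ₁ ℓ₂ : Level) : Set (lsuc (ι ⊔ˡ c ⊔ˡ ℓ₁ ⊔ˡ ℓ₂)) where
  field
    poset : Poset c ℓ₁ ℓ₂

  open Poset poset public renaming (_≤_ to _⊑_)

  Subset : Set (c ⊔ˡ lsuc (ι ⊔ˡ ℓ₁))
  Subset = Pred Carrier (ι ⊔ˡ ℓ₁)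

  Small : Subset → Set (c ⊔ˡ ℓ₁ ⊔ˡ lsuc ι)
  Small = IsSmall poset ι

  field
    ⨆     : (S : Subset) → Small S → IsDirected _⊑_ S → Carrier
    ⨆-sup : (S : Subset) (sm : Small S) (dir : IsDirected _⊑_ S) →
            IsSupremum _⊑_ S (⨆ S sm dir)

  infix 4 _≪_

  _≪_ : Rel Carrier (c ⊔ˡ ℓ₂ ⊔ˡ lsuc (ι ⊔ˡ ℓ₁))
  x ≪ y = (S : Subset) (sm : Small S) (dir : IsDirected _⊑_ S) →
          y ⊑ ⨆ S sm dir → ∃ λ s → s ∈ S × x ⊑ s

  IsContinuous : Set (c ⊔ˡ ℓ₂ ⊔ˡ lsuc (ι ⊔ˡ ℓ₁))
  IsContinuous = ∀ x → IsDirected _⊑_ (_≪ x) × IsSupremum _⊑_ (_≪ x) x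

record ContinuousDCPO (ι c ℓ₁ ℓ₂ : Level) : Set (lsuc (ι ⊔ˡ c ⊔ˡ ℓ₁ ⊔ˡ ℓ₂)) where
  field
    dcpo         : DCPO ι c ℓ₁ ℓ₂
    isContinuous : DCPO.IsContinuous dcpo

  open DCPO dcpo public

  IsSharp : Carrier → Set (c ⊔ˡ ℓ₂ ⊔ˡ lsuc (ι ⊔ˡ ℓ₁))
  IsSharp x = ∀ y z → y ≪ z → (y ≪ x) ⊎ (¬ (z ⊑ x))

record LowerReal : Set₁ where
  field
    cut      : Pred ℚ 0ℓ
    lower    : ∀ {p q} → p < q → q ∈ cut → p ∈ cut
    directed : IsDirected _<_ cut

open LowerReal public

lowerRealPoset : Poset (lsuc 0ℓ) 0ℓ 0ℓ
lowerRealPoset = record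
  { Carrier = LowerReal
  ; _≈_ = λ L M → cut L ≐ cut M
  ; _≤_ = λ L M → cut L ⊆ cut M
  ; isPartialOrder = record
    { isPreorder = record
      { isEquivalence = record
        { refl  = (λ p → p) , (λ p → p)
        ; sym   = λ (f , g) → g , f
        ; trans = λ (f , g) (h , k) → (λ p → h (f p)) , (λ p → g (k p))
        }
      ; reflexive = proj₁
      ; trans     = λ f g p → g (f p)
      }
    ; antisym = λ f g → f , g
    }
  }

-- The union is taken over an enumeration of S, because the union over the
-- members of S themselves would be a predicate on ℚ of level 1.
⋃ : (S : Pred LowerReal 0ℓ) → IsSmall lowerRealPoset 0ℓ S →
    IsDirected (Poset._≤_ lowerRealPoset) S → LowerReal
⋃ S (I , α , S⊆α , α⊆S) ((L₀ , L₀∈S) , up) = record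
  { cut      = λ q → ∃ λ i → q ∈ cut (α i)
  ; lower    = λ p<q (i , q∈αi) → i , lower (α i) p<q q∈αi
  ; directed = inhabited , upper-bound
  }
  where
  member : ∀ i → α i ∈ S
  member i = α⊆S (i , (λ p → p) , (λ p → p))

  inhabited : ∃ λ q → ∃ λ i → q ∈ cut (α i)
  inhabited with S⊆α L₀∈S | proj₁ (directed L₀)
  ... | i , L₀⊆αi , _ | q , q∈L₀ = q , i , L₀⊆αi q∈L₀

  upper-bound : ∀ p q → (∃ λ i → p ∈ cut (α i)) → (∃ λ i → q ∈ cut (α i)) →
                ∃ λ r → (∃ λ i → r ∈ cut (α i)) × p < r × q < r
  upper-bound p q (i , p∈αi) (j , q∈αj) with up (α i) (α j) (member i) (member j)
  ... | M , M∈S , αi⊆M , αj⊆M with S⊆α M∈S | proj₂ (directed M) p q (αi⊆M p∈αi) (αj⊆M q∈αj)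
  ... | k , M⊆αk , _ | r , r∈M , p<r , q<r = r , (k , M⊆αk r∈M) , p<r , q<r

lowerRealDCPO : DCPO 0ℓ (lsuc 0ℓ) 0ℓ 0ℓ
lowerRealDCPO = record
  { poset = lowerRealPoset
  ; ⨆     = ⋃
  ; ⨆-sup = λ S (I , α , S⊆α , α⊆S) dir →
      (λ L L∈S p∈L → let (i , L⊆αi , _) = S⊆α L∈S in i , L⊆αi p∈L) ,
      (λ M ub (i , p∈αi) → ub (α i) (α⊆S (i , (λ p → p) , (λ p → p))) p∈αi)
  }

open DCPO lowerRealDCPO using (_⊑_; _≪_; Small; Subset)

p-1<p : ∀ p → p + (- 1ℚ) < p
p-1<p p = subst (p + (- 1ℚ) <_) (+-identityʳ p)
  (+-monoʳ-< p (from-yes ((- 1ℚ) <? 0ℚ)))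

↓ : ℚ → LowerReal
↓ p = record
  { cut      = _< p
  ; lower    = <-trans
  ; directed = (_ , p-1<p p) , upper-bound
  }
  where
  upper-bound : ∀ x y → x < p → y < p → ∃ λ r → r < p × x < r × y < r
  upper-bound x y x<p y<p with <-dense x⊔y<p
    where
    x⊔y<p : x ⊔ y < p
    x⊔y<p with ⊔-sel x y
    ... | inj₁ e = subst (_< p) (sym e) x<p
    ... | inj₂ e = subst (_< p) (sym e) y<p
  ... | r , x⊔y<r , r<p =
    r , r<p , ≤-<-trans (p≤p⊔q x y) x⊔y<r , ≤-<-trans (p≤q⊔p x y) x⊔y<r

∈⇒↓⊑ : ∀ L {p} → p ∈ cut L → ↓ p ⊑ L
∈⇒↓⊑ L p∈L q<p = lower L q<p p∈L

∈⇒↓≪ : ∀ L {p} → p ∈ cut L → ↓ p ≪ L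
∈⇒↓≪ L p∈L S (I , α , _ , α⊆S) dir L⊆⋃ with L⊆⋃ p∈L
... | i , p∈αi = α i , α⊆S (i , (λ p → p) , (λ p → p)) , ∈⇒↓⊑ (α i) p∈αi

≪⇒⊑↓ : ∀ K L → K ≪ L → ∃ λ p → p ∈ cut L × K ⊑ ↓ p
≪⇒⊑↓ K L K≪L with K≪L S small dir L⊆⋃
  where
  α : ∃ (cut L) → LowerReal
  α (p , _) = ↓ p

  S : Subset
  S = Image lowerRealPoset α

  small : Small S
  small = ∃ (cut L) , α , (λ x → x) , (λ x → x)

  dir : IsDirected _⊑_ S
  dir = (let (p , p∈L) = proj₁ (directed L)
         in ↓ p , (p , p∈L) , (λ x → x) , (λ x → x)) ,
        λ _ _ ((p , p∈L) , x⊆p , _) ((q , q∈L) , y⊆q , _) →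
          let (r , r∈L , p<r , q<r) = proj₂ (directed L) p q p∈L q∈L
          in ↓ r , ((r , r∈L) , (λ x → x) , (λ x → x)) ,
             (λ t → <-trans (x⊆p t) p<r) , (λ t → <-trans (y⊆q t) q<r)

  L⊆⋃ : L ⊑ ⋃ S small dir
  L⊆⋃ {p} p∈L = let (r , r∈L , p<r , _) = proj₂ (directed L) p p p∈L p∈L
            in (r , r∈L) , p<r
... | M , ((p , p∈L) , M⊆p , _) , K⊆M = p , p∈L , λ t → M⊆p (K⊆M t)

lowerReal-isContinuous : DCPO.IsContinuous lowerRealDCPO
lowerReal-isContinuous L = (inhabited , upper-bound) , below , least
  where
  inhabited : ∃ λ K → K ≪ L
  inhabited = let (p , p∈L) = proj₁ (directed L) in ↓ p , ∈⇒↓≪ L p∈L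

  upper-bound : ∀ K M → K ≪ L → M ≪ L → ∃ λ N → N ≪ L × K ⊑ N × M ⊑ N
  upper-bound K M K≪L M≪L =
    let (p , p∈L , K⊑p) = ≪⇒⊑↓ K L K≪L
        (q , q∈L , M⊑q) = ≪⇒⊑↓ M L M≪L
        (r , r∈L , p<r , q<r) = proj₂ (directed L) p q p∈L q∈L
    in ↓ r , ∈⇒↓≪ L r∈L , (λ t → <-trans (K⊑p t) p<r) , (λ t → <-trans (M⊑q t) q<r)

  below : ∀ K → K ≪ L → K ⊑ L
  below K K≪L t = let (p , p∈L , K⊑p) = ≪⇒⊑↓ K L K≪L in lower L (K⊑p t) p∈L

  least : ∀ M → (∀ K → K ≪ L → K ⊑ M) → L ⊑ M
  least M ub {p} p∈L = let (r , r∈L , p<r , _) = proj₂ (directed L) p p p∈L p∈L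
                 in ub (↓ r) (∈⇒↓≪ L r∈L) p<r

𝓛 : ContinuousDCPO 0ℓ (lsuc 0ℓ) 0ℓ 0ℓ
𝓛 = record { dcpo = lowerRealDCPO ; isContinuous = lowerReal-isContinuous }

upperCut : LowerReal → Pred ℚ 0ℓ
upperCut L q = ∃ λ s → s ∉ cut L × s < q

IsLocated : Pred ℚ 0ℓ → Pred ℚ 0ℓ → Set
IsLocated L U = ∀ p q → p < q → p ∈ L ⊎ q ∈ U

{-# OPTIONS --safe #-}
module Submission where

open import Defs
open import Data.Product using (_,_; proj₁; proj₂)
open import Data.Rational.Properties using (<-dense)
open import Data.Sum using (inj₁; inj₂)
open import Function.Bundles using (_⇔_; mk⇔)
open import Relation.Unary using (_∈_)

open ContinuousDCPO 𝓛 using (_⊑_; _≪_; IsSharp)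

-- Way-below in `𝓛` is governed by rationals: `K ≪ L` iff `K ⊑ ↓ p` for some `p` in `L` (`≪⇒⊑↓`,
-- `⊑↓∈⇒≪`). So sharpness is decided by pairs `↓ m ≪ ↓ r` with `m < r`, where, up to density, it
-- says that `L` is located.

≪⇒⊑ : ∀ K L → K ≪ L → K ⊑ L
≪⇒⊑ K L = proj₁ (proj₂ (lowerReal-isContinuous L)) K

⊑↓∈⇒≪ : ∀ K L {p} → K ⊑ ↓ p → p ∈ cut L → K ≪ L
⊑↓∈⇒≪ K L K⊑↓p p∈L S sm dir L⊑⋃ =
  let (M , M∈S , ↓p⊑M) = ∈⇒↓≪ L p∈L S sm dir L⊑⋃
  in M , M∈S , λ t → ↓p⊑M (K⊑↓p t)

-- Given p < q, interpolate p < m < r < q and apply sharpness to ↓ m ≪ ↓ r.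
sharp⇒located : ∀ L → IsSharp L → IsLocated (cut L) (upperCut L)
sharp⇒located L sharp p q p<q with <-dense p<q
... | r , p<r , r<q with <-dense p<r
... | m , p<m , m<r with sharp (↓ m) (↓ r) (∈⇒↓≪ (↓ r) m<r)
... | inj₁ ↓m≪L = inj₁ (≪⇒⊑ (↓ m) L ↓m≪L p<m)
... | inj₂ ↓r⋢L = inj₂ (r , (λ r∈L → ↓r⋢L (∈⇒↓⊑ L r∈L)) , r<q)

-- If K ≪ M, there are p < q in M with K ⊑ ↓ p; locate L with respect to them.
located⇒sharp : ∀ L → IsLocated (cut L) (upperCut L) → IsSharp L
located⇒sharp L located K M K≪M with ≪⇒⊑↓ K M K≪M
... | p , p∈M , K⊑↓p with proj₂ (directed M) p p p∈M p∈M
... | q , q∈M , p<q , _ with located p q p<q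
... | inj₁ p∈L = inj₁ (⊑↓∈⇒≪ K L K⊑↓p p∈L)
-- The witness `s` lies in `M`, being below `q`, but not in `L`, so it refutes `M ⊑ L`.
... | inj₂ (s , s∉L , s<q) = inj₂ λ M⊑L → s∉L (M⊑L (lower M s<q q∈M))

theorem7p22 : (L : LowerReal) → ContinuousDCPO.IsSharp 𝓛 L ⇔ IsLocated (cut L) (upperCut L)
theorem7p22 L = mk⇔ (sharp⇒located L) (located⇒sharp L)
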